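{- If $0<q<1$, then $$\frac{\sqrt{1+8xq}-(1+2q)}{2q^2}< Z_q^*(x)\le \frac{\sqrt{1+8xq}-1}{2q},\qquad x\ge \frac{\Gamma_q(3)}{2\Gamma_q(1)}.$$
   Context: $N=\{1,2,3,\dots\}$ denotes the set of positive integers. For $0<q<1$, the $q$-gamma function is $$\Gamma_q(x)=\frac{(q;q)_\infty}{(q^x;q)_\infty}(1-q)^{1-x},\qquad (a;q)_\infty=\prod_{n=0}^\infty(1-aq^n).$$ For $0<q<1$ and $x\in\left[\frac{\Gamma_q(3)}{2\Gamma_q(1)},\infty\right)$ define $$Z_q^*(x)=\max\left\{\frac{1-q^m}{1-q}: m\in N,\ \frac{\Gamma_q(m+2)}{2\Gamma_q(m)}\le x\right\}.$$
   Formalization: The bounds are stated for those x at which the maximum defining Z_q^*(x) exists; for x ≥ 1/(2(1−q)^2) every m is admissible and no maximum exists, so Z_q^*(x) is undefined there (and the lower bound fails for the supremum). -}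

module Defs where

open import Algebra.Bundles using (CommutativeRing)
open import Algebra.Core using (Op₁; Op₂)
open import Algebra.Structures using (IsCommutativeRing)
open import Data.Integer.Base as ℤ using (ℤ)
open import Data.Nat.Base as ℕ using (ℕ; zero; suc)
import Data.Nat.Properties as ℕ
open import Data.Product.Base using (∃; _×_; _,_; proj₁; proj₂)
open import Data.Sum.Base using (_⊎_; inj₁; inj₂)
open import Level using (_⊔_) renaming (suc to ℓsuc)
open import Relation.Binary.Bundles using (StrictPartialOrder)
open import Relation.Binary.Core using (Rel)
open import Relation.Binary.Definitions using (Tri; tri<; tri≈; tri>)
open import Relation.Binary.Structures using (IsStrictTotalOrder)
import Relation.Binary.Construct.StrictToNonStrict as StrictToNonStrict
open import Relation.Nullary.Negation.Core using (¬_; contradiction)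
open import Relation.Unary using (Pred)

-- The real numbers, given axiomatically as a Dedekind-complete ordered field;
-- such a field is unique up to isomorphism.
--   * The order is trichotomous and suprema exist for all inhabited bounded
--     predicates, so these are the classical reals.
--   * _⁻¹ is total; its value at 0# is unspecified.
record RealField c ℓ₁ ℓ₂ : Set (ℓsuc (c ⊔ ℓ₁ ⊔ ℓ₂)) where
  infix  9 _⁻¹
  infix  8 -_
  infixl 7 _*_ _/_
  infixl 6 _+_
  infix  4 _≈_ _<_
  field
    Carrier            : Set c
    _≈_                : Rel Carrier ℓ₁
    _<_                : Rel Carrier ℓ₂
    _+_                : Op₂ Carrier
    _*_                : Op₂ Carrier
    -_                 : Op₁ Carrier
    _⁻¹                : Op₁ Carrier
    0#                 : Carrier
    1#                 : Carrier
    isCommutativeRing  : IsCommutativeRing _≈_ _+_ _*_ -_ 0# 1#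
    ⁻¹-cong            : ∀ {x y} → x ≈ y → x ⁻¹ ≈ y ⁻¹
    *-inverseʳ         : ∀ x → ¬ (x ≈ 0#) → x * x ⁻¹ ≈ 1#
    0≉1                : ¬ (0# ≈ 1#)
    isStrictTotalOrder : IsStrictTotalOrder _≈_ _<_
    +-monoˡ-<          : ∀ z {x y} → x < y → x + z < y + z
    *-pos              : ∀ {x y} → 0# < x → 0# < y → 0# < x * y

  open StrictToNonStrict _≈_ _<_ public using (_≤_)

  UpperBound : ∀ {ℓ} → Pred Carrier ℓ → Carrier → Set (c ⊔ ℓ₁ ⊔ ℓ₂ ⊔ ℓ)
  UpperBound P b = ∀ {x} → P x → x ≤ b

  -- "No y < s is an upper bound" is stated positively: some element of P
  -- exceeds y.
  IsSupremum : ∀ {ℓ} → Pred Carrier ℓ → Carrier → Set (c ⊔ ℓ₁ ⊔ ℓ₂ ⊔ ℓ)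
  IsSupremum P s = UpperBound P s × (∀ {y} → y < s → ∃ λ x → P x × y < x)

  field
    sup : (P : Pred Carrier (ℓ₁ ⊔ ℓ₂)) → ∃ P → ∃ (UpperBound P) → ∃ (IsSupremum P)

  commutativeRing : CommutativeRing c ℓ₁
  commutativeRing = record { isCommutativeRing = isCommutativeRing }

  open CommutativeRing commutativeRing public
    using (_-_; semiring; ring; commutativeSemiring; setoid; refl; sym; trans;
           +-cong; +-congˡ; +-congʳ; +-assoc; +-comm; +-identityˡ; +-identityʳ;
           -‿cong; -‿inverseˡ; -‿inverseʳ; *-cong; *-congˡ; *-congʳ; *-assoc; *-comm;
           *-identityˡ; *-identityʳ; distribˡ; distribʳ; zeroˡ; zeroʳ)
  open import Algebra.Properties.Semiring.Exp semiring public using (_^_)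
  open IsStrictTotalOrder isStrictTotalOrder public
    using (compare; isStrictPartialOrder; <-resp-≈; isEquivalence; irrefl)
    renaming (trans to <-trans)

  _/_ : Op₂ Carrier
  x / y = x * y ⁻¹

  fromℕ : ℕ → Carrier
  fromℕ zero    = 0#
  fromℕ (suc n) = fromℕ n + 1#

  infixr 8 _^ᶻ_
  _^ᶻ_ : Carrier → ℤ → Carrier
  x ^ᶻ (ℤ.+ n)      = x ^ n
  x ^ᶻ ℤ.-[1+ n ]   = (x ^ suc n) ⁻¹

  IsMaximum : ∀ {ℓ} → Pred Carrier ℓ → Carrier → Set (c ⊔ ℓ₁ ⊔ ℓ₂ ⊔ ℓ)
  IsMaximum P z = P z × UpperBound P z

  infix 4 _⟶_
  _⟶_ : (ℕ → Carrier) → Carrier → Set (c ⊔ ℓ₂)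
  f ⟶ l = ∀ ε → 0# < ε → ∃ λ N → ∀ n → N ℕ.≤ n → (l - ε < f n) × (f n < l + ε)

  ∏ : (ℕ → Carrier) → ℕ → Carrier
  ∏ f zero    = 1#
  ∏ f (suc n) = ∏ f n * f n

  strictPartialOrder : StrictPartialOrder c ℓ₁ ℓ₂
  strictPartialOrder = record { isStrictPartialOrder = isStrictPartialOrder }

module RealFieldProperties {c ℓ₁ ℓ₂} (ℝ : RealField c ℓ₁ ℓ₂) where
  open RealField ℝ
  open import Algebra.Properties.Ring ring
    using (-1*x≈-x; -‿involutive)
  open import Algebra.Solver.Ring.NaturalCoefficients.Default commutativeSemiring
  open import Relation.Binary.Reasoning.StrictPartialOrder strictPartialOrder

  ≤-refl : ∀ {x} → x ≤ x
  ≤-refl = inj₂ refl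

  ≤-trans : ∀ {x y z} → x ≤ y → y ≤ z → x ≤ z
  ≤-trans = StrictToNonStrict.trans _≈_ _<_ isEquivalence <-resp-≈ <-trans

  ≤-total : ∀ x y → x ≤ y ⊎ y ≤ x
  ≤-total = StrictToNonStrict.total _≈_ _<_ compare

  ≤⇒≯ : ∀ {x y} → x ≤ y → ¬ (y < x)
  ≤⇒≯ {x} {y} x≤y y<x = irrefl refl (begin-strict x ≤⟨ x≤y ⟩ y <⟨ y<x ⟩ x ∎)

  ≮⇒≥ : ∀ {x y} → ¬ (x < y) → y ≤ x
  ≮⇒≥ {x} {y} x≮y with compare x y
  ... | tri< x<y _ _ = contradiction x<y x≮y
  ... | tri≈ _ x≈y _ = inj₂ (sym x≈y)
  ... | tri> _ _ y<x = inj₁ y<x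

  x-y+y≈x : ∀ x y → x - y + y ≈ x
  x-y+y≈x x y = trans (+-assoc x (- y) y) (trans (+-congˡ (-‿inverseˡ y)) (+-identityʳ x))

  x+y-y≈x : ∀ x y → x + y - y ≈ x
  x+y-y≈x x y = trans (+-assoc x y (- y)) (trans (+-congˡ (-‿inverseʳ y)) (+-identityʳ x))

  +-monoˡ-≤ : ∀ z {x y} → x ≤ y → x + z ≤ y + z
  +-monoˡ-≤ z (inj₁ x<y) = inj₁ (+-monoˡ-< z x<y)
  +-monoˡ-≤ z (inj₂ x≈y) = inj₂ (+-congʳ x≈y)

  +-monoʳ-< : ∀ z {x y} → x < y → z + x < z + y
  +-monoʳ-< z {x} {y} x<y = begin-strict
    z + x ≈⟨ +-comm z x ⟩ x + z <⟨ +-monoˡ-< z x<y ⟩ y + z ≈⟨ +-comm y z ⟩ z + y ∎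

  +-monoʳ-≤ : ∀ z {x y} → x ≤ y → z + x ≤ z + y
  +-monoʳ-≤ z (inj₁ x<y) = inj₁ (+-monoʳ-< z x<y)
  +-monoʳ-≤ z (inj₂ x≈y) = inj₂ (+-congˡ x≈y)

  +-mono-≤ : ∀ {x y u v} → x ≤ y → u ≤ v → x + u ≤ y + v
  +-mono-≤ {y = y} {u} x≤y u≤v = ≤-trans (+-monoˡ-≤ u x≤y) (+-monoʳ-≤ y u≤v)

  +-cancelʳ-≤ : ∀ z {x y} → x + z ≤ y + z → x ≤ y
  +-cancelʳ-≤ z p = ≮⇒≥ λ y<x → ≤⇒≯ p (+-monoˡ-< z y<x)

  <⇒0<- : ∀ {x y} → x < y → 0# < y - x
  <⇒0<- {x} {y} x<y = begin-strict
    0# ≈⟨ -‿inverseʳ x ⟨ x - x <⟨ +-monoˡ-< (- x) x<y ⟩ y - x ∎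

  ≤⇒0≤- : ∀ {x y} → x ≤ y → 0# ≤ y - x
  ≤⇒0≤- {x} {y} x≤y = begin
    0# ≈⟨ -‿inverseʳ x ⟨ x - x ≤⟨ +-monoˡ-≤ (- x) x≤y ⟩ y - x ∎

  -‿anti-≤ : ∀ {x y} → x ≤ y → - y ≤ - x
  -‿anti-≤ {x} {y} x≤y = begin
    - y             ≈⟨ x-y+y≈x (- y) x ⟨
    - y - x + x     ≤⟨ +-monoʳ-≤ (- y - x) x≤y ⟩
    - y - x + y     ≈⟨ solve 3 (λ a b d → a :+ b :+ d := b :+ (a :+ d)) refl (- y) (- x) y ⟩
    - x + (- y + y) ≈⟨ trans (+-congˡ (-‿inverseˡ y)) (+-identityʳ (- x)) ⟩
    - x             ∎

  -‿anti-< : ∀ {x y} → x < y → - y < - x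
  -‿anti-< {x} {y} x<y = begin-strict
    - y             ≈⟨ x-y+y≈x (- y) x ⟨
    - y - x + x     <⟨ +-monoʳ-< (- y - x) x<y ⟩
    - y - x + y     ≈⟨ solve 3 (λ a b d → a :+ b :+ d := b :+ (a :+ d)) refl (- y) (- x) y ⟩
    - x + (- y + y) ≈⟨ trans (+-congˡ (-‿inverseˡ y)) (+-identityʳ (- x)) ⟩
    - x             ∎

  x-y≤x : ∀ {x y} → 0# ≤ y → x - y ≤ x
  x-y≤x {x} {y} 0≤y = begin
    x - y      ≈⟨ +-identityʳ (x - y) ⟨
    x - y + 0# ≤⟨ +-monoʳ-≤ (x - y) 0≤y ⟩
    x - y + y  ≈⟨ x-y+y≈x x y ⟩
    x          ∎

  0<1 : 0# < 1#
  0<1 with compare 0# 1#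
  ... | tri< 0<1 _ _ = 0<1
  ... | tri≈ _ 0≈1 _ = contradiction 0≈1 0≉1
  ... | tri> _ _ 1<0 = begin-strict
    0#              <⟨ *-pos 0<-1 0<-1 ⟩
    - 1# * - 1#     ≈⟨ -1*x≈-x (- 1#) ⟩
    - - 1#          ≈⟨ -‿involutive 1# ⟩
    1#              ∎
    where
    0<-1 : 0# < - 1#
    0<-1 = begin-strict 0# <⟨ <⇒0<- 1<0 ⟩ 0# - 1# ≈⟨ +-identityˡ (- 1#) ⟩ - 1# ∎

  *-monoˡ-< : ∀ {z} → 0# < z → ∀ {x y} → x < y → x * z < y * z
  *-monoˡ-< {z} 0<z {x} {y} x<y = begin-strict
    x * z                ≈⟨ +-identityˡ (x * z) ⟨
    0# + x * z           <⟨ +-monoˡ-< (x * z) (*-pos (<⇒0<- x<y) 0<z) ⟩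
    (y - x) * z + x * z  ≈⟨ distribʳ z (y - x) x ⟨
    (y - x + x) * z      ≈⟨ *-congʳ (x-y+y≈x y x) ⟩
    y * z                ∎

  *-monoˡ-≤ : ∀ {z} → 0# ≤ z → ∀ {x y} → x ≤ y → x * z ≤ y * z
  *-monoˡ-≤ (inj₁ 0<z) (inj₁ x<y) = inj₁ (*-monoˡ-< 0<z x<y)
  *-monoˡ-≤ {z} (inj₂ 0≈z) {x} {y} (inj₁ _) = begin
    x * z  ≈⟨ *-congˡ 0≈z ⟨ x * 0# ≈⟨ zeroʳ x ⟩ 0# ≈⟨ zeroʳ y ⟨
    y * 0# ≈⟨ *-congˡ 0≈z ⟩ y * z ∎
  *-monoˡ-≤ _ (inj₂ x≈y) = inj₂ (*-congʳ x≈y)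

  *-monoʳ-≤ : ∀ {z} → 0# ≤ z → ∀ {x y} → x ≤ y → z * x ≤ z * y
  *-monoʳ-≤ {z} 0≤z {x} {y} x≤y = begin
    z * x ≈⟨ *-comm z x ⟩ x * z ≤⟨ *-monoˡ-≤ 0≤z x≤y ⟩ y * z ≈⟨ *-comm y z ⟩ z * y ∎

  *-nonneg : ∀ {x y} → 0# ≤ x → 0# ≤ y → 0# ≤ x * y
  *-nonneg {x} {y} 0≤x 0≤y = begin 0# ≈⟨ zeroˡ y ⟨ 0# * y ≤⟨ *-monoˡ-≤ 0≤y 0≤x ⟩ x * y ∎

  +-nonneg : ∀ {x y} → 0# ≤ x → 0# ≤ y → 0# ≤ x + y
  +-nonneg {x} {y} 0≤x 0≤y = begin 0# ≈⟨ +-identityʳ 0# ⟨ 0# + 0# ≤⟨ +-mono-≤ 0≤x 0≤y ⟩ x + y ∎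

  *-cancelʳ-≤ : ∀ {z} → 0# < z → ∀ {x y} → x * z ≤ y * z → x ≤ y
  *-cancelʳ-≤ 0<z p = ≮⇒≥ λ y<x → ≤⇒≯ p (*-monoˡ-< 0<z y<x)

  *-cancelʳ-< : ∀ {z} → 0# ≤ z → ∀ {x y} → x * z < y * z → x < y
  *-cancelʳ-< 0≤z {x} {y} p with compare x y
  ... | tri< x<y _ _ = x<y
  ... | tri≈ _ x≈y _ = contradiction p (≤⇒≯ (*-monoˡ-≤ 0≤z (inj₂ (sym x≈y))))
  ... | tri> _ _ y<x = contradiction p (≤⇒≯ (*-monoˡ-≤ 0≤z (inj₁ y<x)))

  *-mono-≤-1 : ∀ {x y} → 0# ≤ y → x ≤ 1# → y ≤ 1# → x * y ≤ 1#
  *-mono-≤-1 {x} {y} 0≤y x≤1 y≤1 = begin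
    x * y  ≤⟨ *-monoˡ-≤ 0≤y x≤1 ⟩ 1# * y ≈⟨ *-identityˡ y ⟩ y ≤⟨ y≤1 ⟩ 1# ∎

  >⇒≉ : ∀ {x} → 0# < x → ¬ (x ≈ 0#)
  >⇒≉ 0<x x≈0 = irrefl (sym x≈0) 0<x

  x/y*y≈x : ∀ x {y} → 0# < y → x / y * y ≈ x
  x/y*y≈x x {y} 0<y = begin-equality
    x * y ⁻¹ * y   ≈⟨ solve 3 (λ a b d → a :* b :* d := a :* (d :* b)) refl x (y ⁻¹) y ⟩
    x * (y * y ⁻¹) ≈⟨ *-congˡ (*-inverseʳ y (>⇒≉ 0<y)) ⟩
    x * 1#         ≈⟨ *-identityʳ x ⟩
    x              ∎

  /-pos : ∀ {x y} → 0# < x → 0# < y → 0# < x / y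
  /-pos {x} {y} 0<x 0<y = *-cancelʳ-< (inj₁ 0<y) (begin-strict
    0# * y    ≈⟨ zeroˡ y ⟩
    0#        <⟨ 0<x ⟩
    x         ≈⟨ x/y*y≈x x 0<y ⟨
    x / y * y ∎)

  ^-pos : ∀ {x} → 0# < x → ∀ n → 0# < x ^ n
  ^-pos 0<x zero    = 0<1
  ^-pos 0<x (suc n) = *-pos 0<x (^-pos 0<x n)

  ^-≤1 : ∀ {x} → 0# < x → x ≤ 1# → ∀ n → x ^ n ≤ 1#
  ^-≤1 0<x x≤1 zero    = ≤-refl
  ^-≤1 0<x x≤1 (suc n) = *-mono-≤-1 (inj₁ (^-pos 0<x n)) x≤1 (^-≤1 0<x x≤1 n)

  antitone-converges : (f : ℕ → Carrier) → (∀ n → f (suc n) ≤ f n) → (∀ n → 0# ≤ f n) →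
                       ∃ (f ⟶_)
  antitone-converges f dec 0≤f = - s , conv
    where
    dec′ : ∀ {m n} → m ℕ.≤′ n → f n ≤ f m
    dec′ ℕ.≤′-refl       = ≤-refl
    dec′ (ℕ.≤′-step m≤n) = ≤-trans (dec _) (dec′ m≤n)

    P : Pred Carrier (ℓ₁ ⊔ ℓ₂)
    P y = ∃ λ n → y ≤ - f n

    P-bounded : UpperBound P (- 0#)
    P-bounded (n , y≤) = ≤-trans y≤ (-‿anti-≤ (0≤f n))

    supP = sup P (- f 0 , 0 , ≤-refl) (- 0# , P-bounded)
    s    = proj₁ supP
    ub   = proj₁ (proj₂ supP)
    lub  = proj₂ (proj₂ supP)

    conv : f ⟶ - s
    conv ε 0<ε with lub {s - ε} (begin-strict
        s - ε      ≈⟨ +-identityʳ (s - ε) ⟨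
        s - ε + 0# <⟨ +-monoʳ-< (s - ε) 0<ε ⟩
        s - ε + ε  ≈⟨ x-y+y≈x s ε ⟩
        s          ∎)
    ... | y , (N , y≤) , s-ε<y = N , λ n N≤n → lower n , upper n N≤n
      where
      lower : ∀ n → - s - ε < f n
      lower n = begin-strict
        - s - ε      ≈⟨ +-identityʳ (- s - ε) ⟨
        - s - ε + 0# <⟨ +-monoʳ-< (- s - ε) 0<ε ⟩
        - s - ε + ε  ≈⟨ x-y+y≈x (- s) ε ⟩
        - s          ≤⟨ -‿anti-≤ (ub (n , ≤-refl)) ⟩
        - - f n      ≈⟨ -‿involutive (f n) ⟩
        f n          ∎
      upper : ∀ n → N ℕ.≤ n → f n < - s + ε
      upper n N≤n = begin-strict
        f n                  ≤⟨ dec′ (ℕ.≤⇒≤′ N≤n) ⟩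
        f N                  ≈⟨ -‿involutive (f N) ⟨
        - - f N              ≤⟨ -‿anti-≤ y≤ ⟩
        - y                  <⟨ -‿anti-< s-ε<y ⟩
        - (s - ε)            ≈⟨ x+y-y≈x (- (s - ε)) s ⟨
        - (s - ε) + s - s    ≈⟨ +-congʳ (+-congˡ (x-y+y≈x s ε)) ⟨
        - (s - ε) + (s - ε + ε) - s
          ≈⟨ solve 4 (λ a b d e → a :+ (b :+ d) :+ e := (a :+ b) :+ (e :+ d)) refl
               (- (s - ε)) (s - ε) ε (- s) ⟩
        (- (s - ε) + (s - ε)) + (- s + ε) ≈⟨ +-congʳ (-‿inverseˡ (s - ε)) ⟩
        0# + (- s + ε)       ≈⟨ +-identityˡ (- s + ε) ⟩
        - s + ε              ∎

  abstract
    ∏-converges : (f : ℕ → Carrier) → (∀ n → 0# ≤ f n) → (∀ n → f n ≤ 1#) → ∃ (∏ f ⟶_)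
    ∏-converges f 0≤f f≤1 = antitone-converges (∏ f) dec nonneg
      where
      nonneg : ∀ n → 0# ≤ ∏ f n
      nonneg zero    = inj₁ 0<1
      nonneg (suc n) = *-nonneg (nonneg n) (0≤f n)
      dec : ∀ n → ∏ f (suc n) ≤ ∏ f n
      dec n = begin
        ∏ f n * f n ≤⟨ *-monoʳ-≤ (nonneg n) (f≤1 n) ⟩
        ∏ f n * 1#  ≈⟨ *-identityʳ (∏ f n) ⟩
        ∏ f n       ∎

  module _ {y s : Carrier} (0≤y : 0# ≤ y) (0≤s : 0# ≤ s) where

    below-√-perturb : ∀ {e d M} → s * s + d ≈ y → 0# ≤ e → e ≤ 1# → s + s + 1# ≤ M →
                      e * M ≈ d → (s + e) * (s + e) ≤ y
    below-√-perturb {e} {d} {M} s²+d≈y 0≤e e≤1 2s+1≤M eM≈d = begin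
      (s + e) * (s + e)
        ≈⟨ solve 2 (λ a b → (a :+ b) :* (a :+ b) := a :* a :+ b :* (a :+ a :+ b)) refl s e ⟩
      s * s + e * (s + s + e)
        ≤⟨ +-monoʳ-≤ (s * s) (*-monoʳ-≤ 0≤e (≤-trans (+-monoʳ-≤ (s + s) e≤1) 2s+1≤M)) ⟩
      s * s + e * M  ≈⟨ +-congˡ eM≈d ⟩
      s * s + d      ≈⟨ s²+d≈y ⟩
      y              ∎

    above-√-perturb : ∀ {t e d M} → y + d ≈ s * s → 0# ≤ e → t + e ≈ s → t + s ≤ M →
                      e * M ≈ d → y ≤ t * t
    above-√-perturb {t} {e} {d} {M} y+d≈s² 0≤e t+e≈s t+s≤M eM≈d = +-cancelʳ-≤ d (begin
      y + d                       ≈⟨ y+d≈s² ⟩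
      s * s                       ≈⟨ *-cong t+e≈s t+e≈s ⟨
      (t + e) * (t + e)
        ≈⟨ solve 2 (λ a b → (a :+ b) :* (a :+ b) := a :* a :+ b :* (a :+ (a :+ b))) refl t e ⟩
      t * t + e * (t + (t + e))   ≈⟨ +-congˡ (*-congˡ (+-congˡ t+e≈s)) ⟩
      t * t + e * (t + s)         ≤⟨ +-monoʳ-≤ (t * t) (*-monoʳ-≤ 0≤e t+s≤M) ⟩
      t * t + e * M               ≈⟨ +-congˡ eM≈d ⟩
      t * t + d                   ∎)

    0<2s+1 : 0# < s + s + 1#
    0<2s+1 = begin-strict
      0#          <⟨ 0<1 ⟩
      1#          ≈⟨ +-identityˡ 1# ⟨
      0# + 1#     ≤⟨ +-monoˡ-≤ 1# (+-nonneg 0≤s 0≤s) ⟩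
      s + s + 1#  ∎

    increase : s * s < y → ∃ λ u → s < u × u * u ≤ y
    increase s²<y = s + e , s<s+e ,
      below-√-perturb (trans (+-comm (s * s) d) (x-y+y≈x y (s * s)))
        (inj₁ 0<e) e≤1 2s+1≤M (x/y*y≈x d 0<M)
      where
      d = y - s * s
      0<d : 0# < d
      0<d = <⇒0<- s²<y
      M = s + s + 1# + d
      2s+1≤M : s + s + 1# ≤ M
      2s+1≤M = begin
        s + s + 1#      ≈⟨ +-identityʳ (s + s + 1#) ⟨
        s + s + 1# + 0# ≤⟨ +-monoʳ-≤ (s + s + 1#) (inj₁ 0<d) ⟩
        M               ∎
      0<M : 0# < M
      0<M = begin-strict 0# <⟨ 0<2s+1 ⟩ s + s + 1# ≤⟨ 2s+1≤M ⟩ M ∎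
      e = d / M
      0<e : 0# < e
      0<e = /-pos 0<d 0<M
      e≤1 : e ≤ 1#
      e≤1 = *-cancelʳ-≤ 0<M (begin
        e * M        ≈⟨ x/y*y≈x d 0<M ⟩
        d            ≈⟨ +-identityˡ d ⟨
        0# + d       ≤⟨ +-monoˡ-≤ d (inj₁ 0<2s+1) ⟩
        M            ≈⟨ *-identityˡ M ⟨
        1# * M       ∎)
      s<s+e : s < s + e
      s<s+e = begin-strict s ≈⟨ +-identityʳ s ⟨ s + 0# <⟨ +-monoʳ-< s 0<e ⟩ s + e ∎

    decrease : y < s * s → ∃ λ t → 0# ≤ t × t < s × y ≤ t * t
    decrease y<s² = s - e , 0≤t , t<s ,
      above-√-perturb (trans (+-comm y d) (x-y+y≈x (s * s) y))
        (inj₁ 0<e) (x-y+y≈x s e) t+s≤M (x/y*y≈x d 0<2s+1)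
      where
      d = s * s - y
      M = s + s + 1#
      e = d / M
      0<e : 0# < e
      0<e = /-pos (<⇒0<- y<s²) 0<2s+1
      s≤M : s ≤ M
      s≤M = begin
        s            ≈⟨ +-identityʳ s ⟨
        s + 0#       ≤⟨ +-monoʳ-≤ s (+-nonneg 0≤s (inj₁ 0<1)) ⟩
        s + (s + 1#) ≈⟨ +-assoc s s 1# ⟨
        M            ∎
      0≤t : 0# ≤ s - e
      0≤t = ≤⇒0≤- (*-cancelʳ-≤ 0<2s+1 (begin
        e * M     ≈⟨ x/y*y≈x d 0<2s+1 ⟩
        s * s - y ≤⟨ x-y≤x 0≤y ⟩
        s * s     ≤⟨ *-monoʳ-≤ 0≤s s≤M ⟩
        s * M     ∎))
      t<s : s - e < s
      t<s = begin-strict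
        s - e      ≈⟨ +-identityʳ (s - e) ⟨
        s - e + 0# <⟨ +-monoʳ-< (s - e) 0<e ⟩
        s - e + e  ≈⟨ x-y+y≈x s e ⟩
        s          ∎
      t+s≤M : s - e + s ≤ M
      t+s≤M = begin
        s - e + s   ≤⟨ +-monoˡ-≤ s (x-y≤x (inj₁ 0<e)) ⟩
        s + s       ≈⟨ +-identityʳ (s + s) ⟨
        s + s + 0#  ≤⟨ +-monoʳ-≤ (s + s) (inj₁ 0<1) ⟩
        M           ∎

  module _ {y : Carrier} (0≤y : 0# ≤ y) where

    √-lower : Pred Carrier (ℓ₁ ⊔ ℓ₂)
    √-lower t = 0# ≤ t × t * t ≤ y

    0∈√-lower : √-lower 0#
    0∈√-lower = ≤-refl , (begin 0# * 0# ≈⟨ zeroʳ 0# ⟩ 0# ≤⟨ 0≤y ⟩ y ∎)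

    √-lower-bounded : UpperBound √-lower (y + 1#)
    √-lower-bounded {t} (0≤t , t²≤y) = ≮⇒≥ λ y+1<t → ≤⇒≯ t²≤y (begin-strict
      y              ≈⟨ +-identityʳ y ⟨
      y + 0#         <⟨ +-monoʳ-< y 0<1 ⟩
      y + 1#         <⟨ y+1<t ⟩
      t              ≈⟨ *-identityˡ t ⟨
      1# * t         ≤⟨ *-monoˡ-≤ 0≤t (begin
        1#      ≈⟨ +-identityˡ 1# ⟨
        0# + 1# ≤⟨ +-monoˡ-≤ 1# 0≤y ⟩
        y + 1#  <⟨ y+1<t ⟩
        t       ∎) ⟩
      t * t          ∎)

    √-lower-sup-square : ∀ {s} → 0# ≤ s → IsSupremum √-lower s → s * s ≈ y
    √-lower-sup-square {s} 0≤s (ub , lub) = by-cases (compare (s * s) y)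
      where
      s²≮y : ¬ (s * s < y)
      s²≮y s²<y =
        let u , s<u , u²≤y = increase 0≤y 0≤s s²<y
        in ≤⇒≯ (ub (≤-trans 0≤s (inj₁ s<u) , u²≤y)) s<u

      y≮s² : ¬ (y < s * s)
      y≮s² y<s² =
        let t , 0≤t , t<s , y≤t²   = decrease 0≤y 0≤s y<s²
            x , (0≤x , x²≤y) , t<x = lub t<s
        in ≤⇒≯ x²≤y (begin-strict
          y     ≤⟨ y≤t² ⟩
          t * t ≤⟨ *-monoʳ-≤ 0≤t (inj₁ t<x) ⟩
          t * x <⟨ *-monoˡ-< (begin-strict 0# ≤⟨ 0≤t ⟩ t <⟨ t<x ⟩ x ∎) t<x ⟩
          x * x ∎)

      by-cases : Tri (s * s < y) (s * s ≈ y) (y < s * s) → s * s ≈ y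
      by-cases (tri< s²<y _ _) = contradiction s²<y s²≮y
      by-cases (tri≈ _ s²≈y _) = s²≈y
      by-cases (tri> _ _ y<s²) = contradiction y<s² y≮s²

    abstract
      sqrt-exists : ∃ λ s → 0# ≤ s × s * s ≈ y
      sqrt-exists =
        let s , isSup = sup √-lower (0# , 0∈√-lower) (y + 1# , √-lower-bounded)
            0≤s       = proj₁ isSup 0∈√-lower
        in s , 0≤s , √-lower-sup-square 0≤s isSup

  -- Total, with value 0# at negative arguments.
  √_ : Carrier → Carrier
  √ y with ≤-total 0# y
  ... | inj₁ 0≤y = proj₁ (sqrt-exists 0≤y)
  ... | inj₂ _   = 0#

  √-nonneg : ∀ y → 0# ≤ √ y
  √-nonneg y with ≤-total 0# y
  ... | inj₁ 0≤y = proj₁ (proj₂ (sqrt-exists 0≤y))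
  ... | inj₂ _   = ≤-refl

  √-square : ∀ {y} → 0# ≤ y → √ y * √ y ≈ y
  √-square {y} 0≤y with ≤-total 0# y
  ... | inj₁ 0≤y′ = proj₂ (proj₂ (sqrt-exists 0≤y′))
  ... | inj₂ y≤0  = trans (zeroˡ 0#) (StrictToNonStrict.antisym _≈_ _<_ isEquivalence <-trans irrefl 0≤y y≤0)

module QGamma {c ℓ₁ ℓ₂} (ℝ : RealField c ℓ₁ ℓ₂)
              (q : RealField.Carrier ℝ)
              (0<q : RealField._<_ ℝ (RealField.0# ℝ) q)
              (q<1 : RealField._<_ ℝ q (RealField.1# ℝ)) where
  open RealField ℝ
  open RealFieldProperties ℝ

  q-factor : Carrier → ℕ → Carrier
  q-factor a n = 1# - a * q ^ n

  module _ {a : Carrier} (0≤a : 0# ≤ a) (a≤1 : a ≤ 1#) where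

    q-factor-nonneg : ∀ n → 0# ≤ q-factor a n
    q-factor-nonneg n =
      ≤⇒0≤- (*-mono-≤-1 (inj₁ (^-pos 0<q n)) a≤1 (^-≤1 0<q (inj₁ q<1) n))

    q-factor-≤1 : ∀ n → q-factor a n ≤ 1#
    q-factor-≤1 n = x-y≤x (*-nonneg 0≤a (inj₁ (^-pos 0<q n)))

    q-Pochhammer-converges : ∃ (∏ (q-factor a) ⟶_)
    q-Pochhammer-converges = ∏-converges (q-factor a) q-factor-nonneg q-factor-≤1

  -- (a ; q)_∞, for 0 ≤ a ≤ 1
  q-Pochhammer : (a : Carrier) → 0# ≤ a → a ≤ 1# → Carrier
  q-Pochhammer a 0≤a a≤1 = proj₁ (q-Pochhammer-converges 0≤a a≤1)

  -- The q-gamma function at integer arguments m ≥ 1; at the pole m = 0 the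
  -- value is meaningless, since (q ^ 0 ; q)_∞ = 0.
  Γq : ℕ → Carrier
  Γq m = q-Pochhammer q (inj₁ 0<q) (inj₁ q<1)
       / q-Pochhammer (q ^ m) (inj₁ (^-pos 0<q m)) (^-≤1 0<q (inj₁ q<1) m)
       * (1# - q) ^ᶻ (ℤ.1ℤ ℤ.- ℤ.+ m)

  Z*-set : Carrier → Pred Carrier (ℓ₁ ⊔ ℓ₂)
  Z*-set x y = ∃ λ m → 1 ℕ.≤ m
                     × Γq (m ℕ.+ 2) / (fromℕ 2 * Γq m) ≤ x
                     × y ≈ (1# - q ^ m) / (1# - q)

  -- z is the value of Z*_q(x).  A relation rather than a function, since for
  -- x ≥ 1 / (2 (1 - q)²) every m ≥ 1 is admissible and the maximum does not exist.
  IsZ* : Carrier → Carrier → Set (c ⊔ ℓ₁ ⊔ ℓ₂)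
  IsZ* x z = IsMaximum (Z*-set x) z

-- Since Γq (m + 1) = [m] Γq m with [m] = (1 - q ^ m) / (1 - q), the admissibility
-- ratio Γq (m + 2) / (2 Γq m) equals [m] [m + 1] / 2.  As [m + 1] = 1 + q [m],
-- completing the square turns "m is admissible" into 1 + 2 q [m] ≤ √ (1 + 8 x q).
-- This gives the upper bound for Z = [m]; the lower one is the failure of the same
-- inequality at m + 1.
module Submission where

import Data.Integer.Base as ℤ
open import Data.Nat.Base as ℕ using (ℕ; zero; suc)
import Data.Nat.Properties as ℕ
open import Data.Product.Base using (∃; _×_; _,_; proj₁; proj₂)
open import Data.Sum.Base using (inj₁; inj₂)
open import Defs
open import Relation.Binary.Definitions using (tri<; tri≈; tri>)
import Relation.Binary.Construct.StrictToNonStrict as StrictToNonStrict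
import Relation.Binary.PropositionalEquality.Core as ≡
open import Relation.Nullary.Negation.Core using (¬_; contradiction)

module OrderedFieldLemmas {c ℓ₁ ℓ₂} (ℝ : RealField c ℓ₁ ℓ₂) where
  open RealField ℝ
  open RealFieldProperties ℝ
  open import Algebra.Properties.Ring ring using (x[y-z]≈xy-xz)
  open import Algebra.Solver.Ring.NaturalCoefficients.Default commutativeSemiring
  open import Relation.Binary.Reasoning.StrictPartialOrder strictPartialOrder

  -- Order and cancellation in an ordered field.

  ≤-antisym : ∀ {x y} → x ≤ y → y ≤ x → x ≈ y
  ≤-antisym = StrictToNonStrict.antisym _≈_ _<_ isEquivalence <-trans irrefl

  ≰⇒> : ∀ {x y} → ¬ (x ≤ y) → y < x
  ≰⇒> {x} {y} x≰y with compare x y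
  ... | tri< x<y _ _ = contradiction (inj₁ x<y) x≰y
  ... | tri≈ _ x≈y _ = contradiction (inj₂ x≈y) x≰y
  ... | tri> _ _ y<x = y<x

  x<x+y : ∀ x {y} → 0# < y → x < x + y
  x<x+y x {y} 0<y = begin-strict
    x      ≈⟨ +-identityʳ x ⟨
    x + 0# <⟨ +-monoʳ-< x 0<y ⟩
    x + y  ∎

  x-y<x : ∀ x {y} → 0# < y → x - y < x
  x-y<x x {y} 0<y = begin-strict
    x - y      <⟨ x<x+y (x - y) 0<y ⟩
    x - y + y  ≈⟨ x-y+y≈x x y ⟩
    x          ∎

  x<y+z⇒x-z<y : ∀ {x y z} → x < y + z → x - z < y
  x<y+z⇒x-z<y {x} {y} {z} x<y+z = begin-strict
    x - z     <⟨ +-monoˡ-< (- z) x<y+z ⟩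
    y + z - z ≈⟨ x+y-y≈x y z ⟩
    y         ∎

  x≤y+z⇒x-z≤y : ∀ {x y z} → x ≤ y + z → x - z ≤ y
  x≤y+z⇒x-z≤y {x} {y} {z} x≤y+z = begin
    x - z     ≤⟨ +-monoˡ-≤ (- z) x≤y+z ⟩
    y + z - z ≈⟨ x+y-y≈x y z ⟩
    y         ∎

  x+z≤y⇒x≤y-z : ∀ {x y z} → x + z ≤ y → x ≤ y - z
  x+z≤y⇒x≤y-z {x} {y} {z} x+z≤y = begin
    x         ≈⟨ x+y-y≈x x z ⟨
    x + z - z ≤⟨ +-monoˡ-≤ (- z) x+z≤y ⟩
    y - z     ∎

  *-monoʳ-< : ∀ {z} → 0# < z → ∀ {x y} → x < y → z * x < z * y
  *-monoʳ-< {z} 0<z {x} {y} x<y = begin-strict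
    z * x ≈⟨ *-comm z x ⟩ x * z <⟨ *-monoˡ-< 0<z x<y ⟩ y * z ≈⟨ *-comm y z ⟩ z * y ∎

  *-cancelʳ-≈ : ∀ {z} → 0# < z → ∀ {x y} → x * z ≈ y * z → x ≈ y
  *-cancelʳ-≈ 0<z xz≈yz =
    ≤-antisym (*-cancelʳ-≤ 0<z (inj₂ xz≈yz)) (*-cancelʳ-≤ 0<z (inj₂ (sym xz≈yz)))

  *-pos-cancelʳ : ∀ {x y} → 0# < y → 0# < x * y → 0# < x
  *-pos-cancelʳ {x} {y} 0<y 0<xy = *-cancelʳ-< (inj₁ 0<y) (begin-strict
    0# * y ≈⟨ zeroˡ y ⟩ 0# <⟨ 0<xy ⟩ x * y ∎)

  x<z*y⇒x/y<z : ∀ {x y z} → 0# < y → x < z * y → x / y < z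
  x<z*y⇒x/y<z {x} {y} {z} 0<y x<zy = *-cancelʳ-< (inj₁ 0<y) (begin-strict
    x / y * y ≈⟨ x/y*y≈x x 0<y ⟩ x <⟨ x<zy ⟩ z * y ∎)

  z*y≤x⇒z≤x/y : ∀ {x y z} → 0# < y → z * y ≤ x → z ≤ x / y
  z*y≤x⇒z≤x/y {x} {y} {z} 0<y zy≤x = *-cancelʳ-≤ 0<y (begin
    z * y ≤⟨ zy≤x ⟩ x ≈⟨ x/y*y≈x x 0<y ⟨ x / y * y ∎)

  -- By contraposition: `y < x` makes `x` positive, whence `y * y ≤ y * x < x * x`.
  square-cancel-≤ : ∀ {x y} → 0# ≤ y → x * x ≤ y * y → x ≤ y
  square-cancel-≤ {x} {y} 0≤y x²≤y² = ≮⇒≥ λ y<x → ≤⇒≯ x²≤y² (begin-strict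
    y * y ≤⟨ *-monoʳ-≤ 0≤y (inj₁ y<x) ⟩
    y * x <⟨ *-monoˡ-< (begin-strict 0# ≤⟨ 0≤y ⟩ y <⟨ y<x ⟩ x ∎) y<x ⟩
    x * x ∎)

  square-cancel-< : ∀ {x y} → 0# ≤ y → x * x < y * y → x < y
  square-cancel-< 0≤y x²<y² = ≰⇒> λ y≤x →
    ≤⇒≯ (≤-trans (*-monoʳ-≤ 0≤y y≤x) (*-monoˡ-≤ (≤-trans 0≤y y≤x) y≤x)) x²<y²

  fromℕ-nonneg : ∀ n → 0# ≤ fromℕ n
  fromℕ-nonneg zero    = ≤-refl
  fromℕ-nonneg (suc n) = +-nonneg (fromℕ-nonneg n) (inj₁ 0<1)

  fromℕ-pos : ∀ n → 0# < fromℕ (suc n)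
  fromℕ-pos n = begin-strict
    0#           ≤⟨ fromℕ-nonneg n ⟩
    fromℕ n      <⟨ x<x+y (fromℕ n) 0<1 ⟩
    fromℕ (suc n) ∎

  -- Limits of sequences.

  ⟶-const : ∀ x → (λ _ → x) ⟶ x
  ⟶-const x ε 0<ε = 0 , λ _ _ → x-y<x x 0<ε , x<x+y x 0<ε

  ⟶-suc : ∀ {f l} → f ⟶ l → (λ n → f (suc n)) ⟶ l
  ⟶-suc f⟶l ε 0<ε =
    let N , close = f⟶l ε 0<ε
    in N , λ n N≤n → close (suc n) (ℕ.m≤n⇒m≤1+n N≤n)

  ⟶-*ˡ : ∀ {a f l} → 0# < a → f ⟶ l → (λ n → a * f n) ⟶ a * l
  ⟶-*ˡ {a} {f} {l} 0<a f⟶l ε 0<ε =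
    let N , close = f⟶l (ε / a) (/-pos 0<ε 0<a)
    in N , λ n N≤n →
      (begin-strict
        a * l - ε           ≈⟨ +-congˡ (-‿cong a*[ε/a]≈ε) ⟨
        a * l - a * (ε / a) ≈⟨ x[y-z]≈xy-xz a l (ε / a) ⟨
        a * (l - ε / a)     <⟨ *-monoʳ-< 0<a (proj₁ (close n N≤n)) ⟩
        a * f n             ∎) ,
      (begin-strict
        a * f n             <⟨ *-monoʳ-< 0<a (proj₂ (close n N≤n)) ⟩
        a * (l + ε / a)     ≈⟨ distribˡ a l (ε / a) ⟩
        a * l + a * (ε / a) ≈⟨ +-congˡ a*[ε/a]≈ε ⟩
        a * l + ε           ∎)
    where
    a*[ε/a]≈ε : a * (ε / a) ≈ ε
    a*[ε/a]≈ε = trans (*-comm a (ε / a)) (x/y*y≈x ε 0<a)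

  ⟶-mono-≤ : ∀ {f g k l} → (∀ n → f n ≤ g n) → f ⟶ k → g ⟶ l → k ≤ l
  ⟶-mono-≤ {f} {g} {k} {l} f≤g f⟶k g⟶l = ≮⇒≥ λ l<k →
    -- With `ε` half the gap, `k - ε` and `l + ε` coincide, so `g n` would lie below `f n` beyond
    -- both thresholds.
    let ε   = (k - l) / fromℕ 2
        0<ε = /-pos (<⇒0<- l<k) (fromℕ-pos 1)
        M , f-close = f⟶k ε 0<ε
        N , g-close = g⟶l ε 0<ε
        n = M ℕ.⊔ N
    in irrefl refl (begin-strict
      k - ε         <⟨ proj₁ (f-close n (ℕ.m≤m⊔n M N)) ⟩
      f n           ≤⟨ f≤g n ⟩
      g n           <⟨ proj₂ (g-close n (ℕ.m≤n⊔m M N)) ⟩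
      l + ε         ≈⟨ x+y-y≈x (l + ε) ε ⟨
      l + ε + ε - ε ≈⟨ +-congʳ (begin-equality
        l + ε + ε       ≈⟨ solve 2 (λ x y → x :+ y :+ y := y :* con 2 :+ x) refl l ε ⟩
        ε * (1# + 1#) + l ≈⟨ +-congʳ (*-congˡ (+-congʳ (sym (+-identityˡ 1#)))) ⟩
        ε * fromℕ 2 + l ≈⟨ +-congʳ (x/y*y≈x (k - l) (fromℕ-pos 1)) ⟩
        k - l + l       ≈⟨ x-y+y≈x k l ⟩
        k               ∎) ⟩
      k - ε         ∎)

  ⟶-unique : ∀ {f g k l} → (∀ n → f n ≈ g n) → f ⟶ k → g ⟶ l → k ≈ l
  ⟶-unique f≈g f⟶k g⟶l = ≤-antisym
    (⟶-mono-≤ (λ n → inj₂ (f≈g n)) f⟶k g⟶l)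
    (⟶-mono-≤ (λ n → inj₂ (sym (f≈g n))) g⟶l f⟶k)

module QGammaLemmas {c ℓ₁ ℓ₂} (ℝ : RealField c ℓ₁ ℓ₂)
              (q : RealField.Carrier ℝ)
              (0<q : RealField._<_ ℝ (RealField.0# ℝ) q)
              (q<1 : RealField._<_ ℝ q (RealField.1# ℝ)) where
  open RealField ℝ
  open RealFieldProperties ℝ
  open OrderedFieldLemmas ℝ
  open QGamma ℝ q 0<q q<1
  open import Algebra.Solver.Ring.NaturalCoefficients.Default commutativeSemiring
  open import Relation.Binary.Reasoning.StrictPartialOrder strictPartialOrder

  -- Powers of `q`.

  r : Carrier
  r = 1# - q

  0<r : 0# < r
  0<r = <⇒0<- q<1

  r+q≈1 : r + q ≈ 1#
  r+q≈1 = x-y+y≈x 1# q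

  q*x≤x : ∀ {x} → 0# ≤ x → q * x ≤ x
  q*x≤x {x} 0≤x = begin
    q * x  ≤⟨ *-monoˡ-≤ 0≤x (inj₁ q<1) ⟩
    1# * x ≈⟨ *-identityˡ x ⟩
    x      ∎

  q*x-nonneg : ∀ {x} → 0# ≤ x → 0# ≤ q * x
  q*x-nonneg = *-nonneg (inj₁ 0<q)

  q^m-nonneg : ∀ m → 0# ≤ q ^ m
  q^m-nonneg m = inj₁ (^-pos 0<q m)

  q^m≤1 : ∀ m → q ^ m ≤ 1#
  q^m≤1 = ^-≤1 0<q (inj₁ q<1)

  q^1+k<1 : ∀ k → q ^ suc k < 1#
  q^1+k<1 k = begin-strict
    q * q ^ k ≤⟨ *-monoʳ-≤ (inj₁ 0<q) (q^m≤1 k) ⟩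
    q * 1#    ≈⟨ *-identityʳ q ⟩
    q         <⟨ q<1 ⟩
    1#        ∎

  -- The limit l of q ^ n satisfies l ≈ q * l, hence is 0.
  q^n-eventually-below : ∀ {ε} → 0# < ε → ∃ λ n → q ^ n < ε
  q^n-eventually-below {ε} 0<ε =
    let l , q^n⟶l = antitone-converges (q ^_)
                      (λ n → q*x≤x (q^m-nonneg n)) q^m-nonneg
        l≈ql = ⟶-unique (λ _ → refl) (⟶-suc q^n⟶l) (⟶-*ˡ 0<q q^n⟶l)
        l≤0  = ≮⇒≥ λ 0<l → irrefl refl (begin-strict
          l      ≈⟨ l≈ql ⟩
          q * l  <⟨ *-monoˡ-< 0<l q<1 ⟩
          1# * l ≈⟨ *-identityˡ l ⟩
          l      ∎)
        N , close = q^n⟶l ε 0<ε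
    in N , (begin-strict
      q ^ N  <⟨ proj₂ (close N ℕ.≤-refl) ⟩
      l + ε  ≤⟨ +-monoˡ-≤ ε l≤0 ⟩
      0# + ε ≈⟨ +-identityˡ ε ⟩
      ε      ∎)

  -- q-Pochhammer symbols: shift of the parameter and positivity.

  -- `∏` peels off the last factor; here the first one is split off. The remaining factors
  -- `1# - a * q ^ (i + 1)` are those of the parameter `q * a`.
  ∏-q-factor-suc : ∀ a n → ∏ (q-factor a) (suc n) ≈ (1# - a) * ∏ (q-factor (q * a)) n
  ∏-q-factor-suc a zero    = begin-equality
    1# * (1# - a * 1#) ≈⟨ *-identityˡ _ ⟩
    1# - a * 1#        ≈⟨ +-congˡ (-‿cong (*-identityʳ a)) ⟩
    1# - a             ≈⟨ *-identityʳ _ ⟨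
    (1# - a) * 1#      ∎
  ∏-q-factor-suc a (suc n) = begin-equality
    ∏ (q-factor a) (suc n) * (1# - a * (q * q ^ n))
      ≈⟨ *-cong (∏-q-factor-suc a n) (+-congˡ (-‿cong
           (solve 3 (λ x y z → x :* (y :* z) := y :* x :* z) refl a q (q ^ n)))) ⟩
    (1# - a) * ∏ (q-factor (q * a)) n * (1# - q * a * q ^ n)
      ≈⟨ *-assoc _ _ _ ⟩
    (1# - a) * (∏ (q-factor (q * a)) n * (1# - q * a * q ^ n)) ∎

  -- The limit of `∏-q-factor-suc`. The bounds on `q * a` are separate arguments because
  -- `q-Pochhammer` takes them as proofs, and different uses supply different ones.
  q-Pochhammer-step : ∀ {a} (0≤a : 0# ≤ a) (a≤1 : a ≤ 1#) → a < 1# →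
    ∀ 0≤qa qa≤1 → q-Pochhammer a 0≤a a≤1 ≈ (1# - a) * q-Pochhammer (q * a) 0≤qa qa≤1
  q-Pochhammer-step {a} 0≤a a≤1 a<1 0≤qa qa≤1 = ⟶-unique (∏-q-factor-suc a)
    (⟶-suc (proj₂ (q-Pochhammer-converges 0≤a a≤1)))
    (⟶-*ˡ (<⇒0<- a<1) (proj₂ (q-Pochhammer-converges 0≤qa qa≤1)))

  module _ {a : Carrier} (0≤a : 0# ≤ a) (a≤1 : a ≤ 1#) where

    ∏-q-factor-nonneg : ∀ n → 0# ≤ ∏ (q-factor a) n
    ∏-q-factor-nonneg zero    = inj₁ 0<1
    ∏-q-factor-nonneg (suc n) = *-nonneg (∏-q-factor-nonneg n) (q-factor-nonneg 0≤a a≤1 n)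

    ∏-q-factor-≤1 : ∀ n → ∏ (q-factor a) n ≤ 1#
    ∏-q-factor-≤1 zero    = ≤-refl
    ∏-q-factor-≤1 (suc n) =
      *-mono-≤-1 (q-factor-nonneg 0≤a a≤1 n) (∏-q-factor-≤1 n) (q-factor-≤1 0≤a a≤1 n)

    -- The Weierstrass bound ∏ (1 - a q ^ i) ≥ 1 - Σ a q ^ i, multiplied by 1 - q.
    ∏-q-factor-lower : ∀ n → r + a * q ^ n ≤ r * ∏ (q-factor a) n + a
    ∏-q-factor-lower zero    = inj₂ (+-cong (sym (*-identityʳ r)) (*-identityʳ a))
    -- Adding `r * t` restores the left side of the induction hypothesis, since `q * t + r * t`
    -- equals `t`.
    ∏-q-factor-lower (suc n) = +-cancelʳ-≤ (r * t) (begin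
      r + a * (q * q ^ n) + r * t
        ≈⟨ solve 4 (λ r a q u → r :+ a :* (q :* u) :+ r :* (a :* u) := r :+ (r :+ q) :* (a :* u))
             refl r a q (q ^ n) ⟩
      r + (r + q) * t           ≈⟨ +-congˡ (trans (*-congʳ r+q≈1) (*-identityˡ t)) ⟩
      r + t                     ≤⟨ ∏-q-factor-lower n ⟩
      r * p + a                 ≈⟨ +-congʳ (*-congˡ (trans (*-congˡ (x-y+y≈x 1# t)) (*-identityʳ p))) ⟨
      r * (p * (f + t)) + a
        ≈⟨ solve 5 (λ r p f t a → r :* (p :* (f :+ t)) :+ a := r :* (p :* f) :+ a :+ r :* (p :* t))
             refl r p f t a ⟩
      r * (p * f) + a + r * (p * t)
        -- Partial products are at most 1, so the loss `p * t` caused by the new factor is at most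
        -- `t`.
        ≤⟨ +-monoʳ-≤ _ (*-monoʳ-≤ (inj₁ 0<r) (*-monoˡ-≤ 0≤t (∏-q-factor-≤1 n))) ⟩
      r * (p * f) + a + r * (1# * t) ≈⟨ +-congˡ (*-congˡ (*-identityˡ t)) ⟩
      r * (p * f) + a + r * t   ∎)
      where
      t = a * q ^ n
      f = q-factor a n
      p = ∏ (q-factor a) n
      0≤t : 0# ≤ t
      0≤t = *-nonneg 0≤a (q^m-nonneg n)

    -- Dropping the term `a * q ^ n` from the Weierstrass bound and letting `n` grow gives
    -- `r - a ≤ r * P`.
    q-Pochhammer-pos-small : a < r → 0# < q-Pochhammer a 0≤a a≤1
    q-Pochhammer-pos-small a<r = *-pos-cancelʳ 0<r (begin-strict
      0#    <⟨ <⇒0<- a<r ⟩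
      r - a ≤⟨ ⟶-mono-≤ bound (⟶-const (r - a))
                 (⟶-*ˡ 0<r (proj₂ (q-Pochhammer-converges 0≤a a≤1))) ⟩
      r * P ≈⟨ *-comm r P ⟩
      P * r ∎)
      where
      P = q-Pochhammer a 0≤a a≤1
      bound : ∀ n → r - a ≤ r * ∏ (q-factor a) n
      bound n = x≤y+z⇒x-z≤y (begin
        r                        ≈⟨ +-identityʳ r ⟨
        r + 0#                   ≤⟨ +-monoʳ-≤ r (*-nonneg 0≤a (q^m-nonneg n)) ⟩
        r + a * q ^ n            ≤⟨ ∏-q-factor-lower n ⟩
        r * ∏ (q-factor a) n + a ∎)

  -- Each induction step splits off the positive factor `1# - a` and replaces `a` by `q * a`; after
  -- `n` steps the parameter is below `r`, where the Weierstrass bound applies.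
  q-Pochhammer-pos-step : ∀ n {a} (0≤a : 0# ≤ a) (a≤1 : a ≤ 1#) → a < 1# → q ^ n * a < r →
    0# < q-Pochhammer a 0≤a a≤1
  q-Pochhammer-pos-step zero    {a} 0≤a a≤1 _ 1a<r =
    q-Pochhammer-pos-small 0≤a a≤1 (begin-strict a ≈⟨ *-identityˡ a ⟨ 1# * a <⟨ 1a<r ⟩ r ∎)
  q-Pochhammer-pos-step (suc n) {a} 0≤a a≤1 a<1 q^[1+n]a<r = begin-strict
    0#                   <⟨ *-pos (<⇒0<- a<1)
                              (q-Pochhammer-pos-step n 0≤qa (inj₁ qa<1) qa<1 q^n[qa]<r) ⟩
    (1# - a) * q-Pochhammer (q * a) 0≤qa (inj₁ qa<1)
                         ≈⟨ q-Pochhammer-step 0≤a a≤1 a<1 0≤qa (inj₁ qa<1) ⟨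
    q-Pochhammer a 0≤a a≤1 ∎
    where
    0≤qa : 0# ≤ q * a
    0≤qa = q*x-nonneg 0≤a
    qa<1 : q * a < 1#
    qa<1 = begin-strict q * a ≤⟨ q*x≤x 0≤a ⟩ a <⟨ a<1 ⟩ 1# ∎
    q^n[qa]<r : q ^ n * (q * a) < r
    q^n[qa]<r = begin-strict
      q ^ n * (q * a) ≈⟨ solve 3 (λ u q a → u :* (q :* a) := q :* u :* a) refl (q ^ n) q a ⟩
      q * q ^ n * a   <⟨ q^[1+n]a<r ⟩
      r               ∎

  -- Strict positivity is what allows the denominators of `Γq` to be cleared, as `_⁻¹` is
  -- unspecified at 0.
  q-Pochhammer-pos : ∀ {a} (0≤a : 0# ≤ a) (a≤1 : a ≤ 1#) → a < 1# → 0# < q-Pochhammer a 0≤a a≤1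
  q-Pochhammer-pos {a} 0≤a a≤1 a<1 =
    let n , q^n<r = q^n-eventually-below 0<r
    in q-Pochhammer-pos-step n 0≤a a≤1 a<1 (begin-strict
      q ^ n * a  ≤⟨ *-monoʳ-≤ (q^m-nonneg n) a≤1 ⟩
      q ^ n * 1# ≈⟨ *-identityʳ (q ^ n) ⟩
      q ^ n      <⟨ q^n<r ⟩
      r          ∎)

  -- The q-gamma function at positive integers.

  -- [q]∞ is (q ; q)_∞, and [q^ m ]∞ is (q ^ m ; q)_∞.
  [q]∞ : Carrier
  [q]∞ = q-Pochhammer q (inj₁ 0<q) (inj₁ q<1)

  [q]∞-pos : 0# < [q]∞
  [q]∞-pos = q-Pochhammer-pos (inj₁ 0<q) (inj₁ q<1) q<1

  [q^_]∞ : ℕ → Carrier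
  [q^ m ]∞ = q-Pochhammer (q ^ m) (q^m-nonneg m) (q^m≤1 m)

  [q^1+k]∞-pos : ∀ k → 0# < [q^ suc k ]∞
  [q^1+k]∞-pos k = q-Pochhammer-pos (q^m-nonneg (suc k)) (q^m≤1 (suc k)) (q^1+k<1 k)

  -- The integer exponent reduces to `- k`, so the power is `r ^ 0` when `k` is zero and an inverse
  -- otherwise; hence the two cases.
  r^ᶻ-k*r^k≈1 : ∀ k → r ^ᶻ (ℤ.1ℤ ℤ.- ℤ.+ suc k) * r ^ k ≈ 1#
  r^ᶻ-k*r^k≈1 zero    = *-identityˡ 1#
  r^ᶻ-k*r^k≈1 (suc k) =
    trans (*-comm _ _) (*-inverseʳ (r ^ suc k) (>⇒≉ (^-pos 0<r (suc k))))

  -- The definition of `Γq` at `m = k + 1` with denominators cleared. Its right side is independent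
  -- of `k`, so consecutive values can be compared.
  Γq-characterisation : ∀ k → Γq (suc k) * ([q^ suc k ]∞ * r ^ k) ≈ [q]∞
  Γq-characterisation k = begin-equality
    [q]∞ / B * s * (B * r ^ k)
      ≈⟨ solve 4 (λ x s b u → x :* s :* (b :* u) := x :* b :* (s :* u)) refl
           ([q]∞ / B) s B (r ^ k) ⟩
    [q]∞ / B * B * (s * r ^ k)  ≈⟨ *-cong (x/y*y≈x [q]∞ ([q^1+k]∞-pos k)) (r^ᶻ-k*r^k≈1 k) ⟩
    [q]∞ * 1#                   ≈⟨ *-identityʳ [q]∞ ⟩
    [q]∞                        ∎
    where
    B = [q^ suc k ]∞
    s = r ^ᶻ (ℤ.1ℤ ℤ.- ℤ.+ suc k)

  Γq-pos : ∀ k → 0# < Γq (suc k)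
  Γq-pos k = *-pos-cancelʳ (*-pos ([q^1+k]∞-pos k) (^-pos 0<r k)) (begin-strict
    0#     <⟨ [q]∞-pos ⟩
    [q]∞ ≈⟨ Γq-characterisation k ⟨
    Γq (suc k) * ([q^ suc k ]∞ * r ^ k) ∎)

  -- q-integers and the functional equation of `Γq`.

  [_]q : ℕ → Carrier
  [ m ]q = (1# - q ^ m) / r

  []q*r : ∀ m → [ m ]q * r ≈ 1# - q ^ m
  []q*r m = x/y*y≈x (1# - q ^ m) 0<r

  []q-nonneg : ∀ m → 0# ≤ [ m ]q
  []q-nonneg m = z*y≤x⇒z≤x/y 0<r (begin
    0# * r     ≈⟨ zeroˡ r ⟩
    0#         ≤⟨ ≤⇒0≤- (q^m≤1 m) ⟩
    1# - q ^ m ∎)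

  []q-suc : ∀ m → [ suc m ]q ≈ 1# + q * [ m ]q
  []q-suc m = *-cancelʳ-≈ 0<r (begin-equality
    [ suc m ]q * r           ≈⟨ []q*r (suc m) ⟩
    -- `1#` becomes `(1# + q * z) * r + q * u` by means of `r + q ≈ 1#` and `z * r + u ≈ 1#`; the
    -- last summand then cancels.
    1# - q * u               ≈⟨ +-congʳ (begin-equality
      1#                     ≈⟨ r+q≈1 ⟨
      r + q                  ≈⟨ +-congˡ (*-identityʳ q) ⟨
      r + q * 1#             ≈⟨ +-congˡ (*-congˡ (x-y+y≈x 1# u)) ⟨
      r + q * (1# - u + u)   ≈⟨ +-congˡ (*-congˡ (+-congʳ ([]q*r m))) ⟨
      r + q * (z * r + u)
        ≈⟨ solve 4 (λ r q z u → r :+ q :* (z :* r :+ u) := (con 1 :+ q :* z) :* r :+ q :* u)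
             refl r q z u ⟩
      (1# + q * z) * r + q * u ∎) ⟩
    (1# + q * z) * r + q * u - q * u ≈⟨ x+y-y≈x _ (q * u) ⟩
    (1# + q * z) * r         ∎)
    where
    u = q ^ m
    z = [ m ]q

  []q-<-suc : ∀ m → [ m ]q < [ suc m ]q
  []q-<-suc m = *-cancelʳ-< (inj₁ 0<r) (begin-strict
    [ m ]q * r      ≈⟨ []q*r m ⟩
    1# - q ^ m      <⟨ +-monoʳ-< 1# (-‿anti-< (begin-strict
      q * q ^ m     <⟨ *-monoˡ-< (^-pos 0<q m) q<1 ⟩
      1# * q ^ m    ≈⟨ *-identityˡ (q ^ m) ⟩
      q ^ m         ∎)) ⟩
    1# - q ^ suc m  ≈⟨ []q*r (suc m) ⟨
    [ suc m ]q * r  ∎)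

  -- The characterisations at `suc k` and `k` share the value `[q]∞`. Splitting one factor off
  -- `[q^ suc k ]∞` exposes a common positive factor, which is cancelled.
  Γq-suc : ∀ k → Γq (2 ℕ.+ k) ≈ [ suc k ]q * Γq (suc k)
  Γq-suc k = *-cancelʳ-≈ (*-pos ([q^1+k]∞-pos (suc k)) (^-pos 0<r (suc k))) (begin-equality
    Γq (2 ℕ.+ k) * (B * (r * r ^ k))  ≈⟨ Γq-characterisation (suc k) ⟩
    [q]∞                            ≈⟨ Γq-characterisation k ⟨
    G * ([q^ suc k ]∞ * r ^ k)
      ≈⟨ *-congˡ (*-congʳ (q-Pochhammer-step
           (q^m-nonneg (suc k)) (q^m≤1 (suc k)) (q^1+k<1 k)
           (q^m-nonneg (2 ℕ.+ k)) (q^m≤1 (2 ℕ.+ k)))) ⟩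
    G * ((1# - q ^ suc k) * B * r ^ k) ≈⟨ *-congˡ (*-congʳ (*-congʳ ([]q*r (suc k)))) ⟨
    G * (z * r * B * r ^ k)
      ≈⟨ solve 5 (λ g z r b u → g :* (z :* r :* b :* u) := z :* g :* (b :* (r :* u))) refl
           G z r B (r ^ k) ⟩
    z * G * (B * (r * r ^ k))         ∎)
    where
    B = [q^ 2 ℕ.+ k ]∞
    G = Γq (suc k)
    z = [ suc k ]q

  -- The admissibility ratio and completing the square.

  Γq-ratio : ℕ → Carrier
  Γq-ratio m = Γq (m ℕ.+ 2) / (fromℕ 2 * Γq m)

  -- Two applications of `Γq-suc` leave the positive factor `Γq (suc k)` on both sides.
  Γq-ratio-[]q : ∀ k → Γq-ratio (suc k) * fromℕ 2 ≈ [ suc k ]q * [ 2 ℕ.+ k ]q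
  Γq-ratio-[]q k = *-cancelʳ-≈ (Γq-pos k) (begin-equality
    Γq-ratio (suc k) * fromℕ 2 * G  ≈⟨ *-assoc _ _ _ ⟩
    Γq-ratio (suc k) * (fromℕ 2 * G) ≈⟨ x/y*y≈x _ (*-pos (fromℕ-pos 1) (Γq-pos k)) ⟩
    Γq (suc k ℕ.+ 2)                ≡⟨ ≡.cong Γq (ℕ.+-comm (suc k) 2) ⟩
    Γq (3 ℕ.+ k)                    ≈⟨ Γq-suc (suc k) ⟩
    w * Γq (2 ℕ.+ k)                ≈⟨ *-congˡ (Γq-suc k) ⟩
    w * (z * G)                     ≈⟨ solve 3 (λ w z g → w :* (z :* g) := z :* w :* g) refl w z G ⟩
    z * w * G                       ∎)
    where
    G = Γq (suc k)
    z = [ suc k ]q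
    w = [ 2 ℕ.+ k ]q

  discriminant : Carrier → Carrier
  discriminant x = 1# + fromℕ 8 * x * q

  -- The derivative in `z` of the quadratic `q z ² + z - 2 x`, whose discriminant is
  -- `discriminant x`. Its square is that discriminant plus `4 q` times the quadratic.
  linear : Carrier → Carrier
  linear z = 1# + z * (fromℕ 2 * q)

  -- z = [ m ]q is the nonnegative root of q z ² + z = 2 Γq-ratio m.
  complete-square : ∀ k → linear [ suc k ]q * linear [ suc k ]q ≈ discriminant (Γq-ratio (suc k))
  complete-square k = begin-equality
    linear z * linear z
      -- The sums starting with `con 0`, here and below, spell out `fromℕ 2` and `fromℕ 8` as they
      -- unfold.
      ≈⟨ solve 2 (λ z q → (con 1 :+ z :* ((con 0 :+ con 1 :+ con 1) :* q))
                            :* (con 1 :+ z :* ((con 0 :+ con 1 :+ con 1) :* q))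
                       := con 1 :+ con 4 :* (z :* (con 1 :+ q :* z)) :* q) refl z q ⟩
    1# + four * (z * (1# + q * z)) * q ≈⟨ +-congˡ (*-congʳ (*-congˡ (*-congˡ ([]q-suc (suc k))))) ⟨
    1# + four * (z * [ 2 ℕ.+ k ]q) * q ≈⟨ +-congˡ (*-congʳ (*-congˡ (Γq-ratio-[]q k))) ⟨
    1# + four * (ρ * fromℕ 2) * q
      ≈⟨ solve 2 (λ ρ q → con 1 :+ con 4 :* (ρ :* (con 0 :+ con 1 :+ con 1)) :* q
                       := con 1 :+ (con 0 :+ con 1 :+ con 1 :+ con 1 :+ con 1 :+ con 1
                                          :+ con 1 :+ con 1 :+ con 1) :* ρ :* q) refl ρ q ⟩
    discriminant ρ ∎
    where
    z = [ suc k ]q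
    ρ = Γq-ratio (suc k)
    four = 1# + 1# + 1# + 1#

  linear-nonneg : ∀ {z} → 0# ≤ z → 0# ≤ linear z
  linear-nonneg 0≤z =
    +-nonneg (inj₁ 0<1) (*-nonneg 0≤z (inj₁ (*-pos (fromℕ-pos 1) 0<q)))

  discriminant-mono-≤ : ∀ {x y} → x ≤ y → discriminant x ≤ discriminant y
  discriminant-mono-≤ x≤y =
    +-monoʳ-≤ 1# (*-monoˡ-≤ (inj₁ 0<q) (*-monoʳ-≤ (inj₁ (fromℕ-pos 7)) x≤y))

  discriminant-mono-< : ∀ {x y} → x < y → discriminant x < discriminant y
  discriminant-mono-< x<y =
    +-monoʳ-< 1# (*-monoˡ-< 0<q (*-monoʳ-< (fromℕ-pos 7) x<y))

  -- `√` returns the default `0#` at negative arguments; an admissible index bounds the discriminant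
  -- below by a square and excludes that case.
  discriminant-nonneg : ∀ k {x} → Γq-ratio (suc k) ≤ x → 0# ≤ discriminant x
  discriminant-nonneg k {x} ρ≤x = begin
    0#                              ≤⟨ *-nonneg 0≤l 0≤l ⟩
    linear [ suc k ]q * linear [ suc k ]q ≈⟨ complete-square k ⟩
    discriminant (Γq-ratio (suc k)) ≤⟨ discriminant-mono-≤ ρ≤x ⟩
    discriminant x                  ∎
    where
    0≤l = linear-nonneg ([]q-nonneg (suc k))

  linear≤√ : ∀ k {x} → Γq-ratio (suc k) ≤ x → linear [ suc k ]q ≤ √ discriminant x
  linear≤√ k {x} ρ≤x = square-cancel-≤ (√-nonneg (discriminant x)) (begin
    linear [ suc k ]q * linear [ suc k ]q ≈⟨ complete-square k ⟩
    discriminant (Γq-ratio (suc k))       ≤⟨ discriminant-mono-≤ ρ≤x ⟩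
    discriminant x                        ≈⟨ √-square (discriminant-nonneg k ρ≤x) ⟨
    √ discriminant x * √ discriminant x   ∎)

  √<linear : ∀ k {x} → 0# ≤ discriminant x → x < Γq-ratio (suc k) →
             √ discriminant x < linear [ suc k ]q
  √<linear k {x} 0≤D x<ρ = square-cancel-< (linear-nonneg ([]q-nonneg (suc k))) (begin-strict
    √ discriminant x * √ discriminant x   ≈⟨ √-square 0≤D ⟩
    discriminant x                        <⟨ discriminant-mono-< x<ρ ⟩
    discriminant (Γq-ratio (suc k))       ≈⟨ complete-square k ⟨
    linear [ suc k ]q * linear [ suc k ]q ∎)

  -- The two bounds for `Z`.

  Z*-upper : ∀ {x Z} → IsZ* x Z → Z ≤ (√ discriminant x - 1#) / (fromℕ 2 * q)
  -- The index `zero` cannot occur, since admissible indices satisfy `1 ≤ m`.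
  Z*-upper {x} {Z} ((suc k , _ , ρ≤x , Z≈) , _) =
    z*y≤x⇒z≤x/y (*-pos (fromℕ-pos 1) 0<q) (x+z≤y⇒x≤y-z (begin
      Z * (fromℕ 2 * q) + 1#  ≈⟨ trans (+-comm _ _) (+-congˡ (*-congʳ Z≈)) ⟩
      linear [ suc k ]q       ≤⟨ linear≤√ k ρ≤x ⟩
      √ discriminant x        ∎))

  -- If Z = [ m ]q, then m + 1 is inadmissible by maximality, and
  -- linear [ m + 1 ]q = linear (1# + q * Z).
  Z*-lower : ∀ {x Z} → IsZ* x Z →
             (√ discriminant x - (1# + fromℕ 2 * q)) / (fromℕ 2 * q ^ 2) < Z
  Z*-lower {x} {Z} ((suc k , _ , ρ≤x , Z≈) , ub) =
    x<z*y⇒x/y<z (*-pos (fromℕ-pos 1) (^-pos 0<q 2)) (x<y+z⇒x-z<y (begin-strict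
      √ discriminant x             <⟨ √<linear (suc k) (discriminant-nonneg k ρ≤x) x<ρ′ ⟩
      linear [ 2 ℕ.+ k ]q          ≈⟨ +-congˡ (*-congʳ ([]q-suc (suc k))) ⟩
      linear (1# + q * [ suc k ]q) ≈⟨ +-congˡ (*-congʳ (+-congˡ (*-congˡ Z≈))) ⟨
      linear (1# + q * Z)
        -- This regrouping produces the denominator `2 q ²` and the constant `1 + 2 q` of the lower
        -- bound; `t` stands for `fromℕ 2`.
        ≈⟨ solve 3 (λ q z t → con 1 :+ (con 1 :+ q :* z) :* (t :* q)
                           := z :* (t :* (q :* (q :* con 1))) :+ (con 1 :+ t :* q))
             refl q Z (fromℕ 2) ⟩
      Z * (fromℕ 2 * q ^ 2) + (1# + fromℕ 2 * q) ∎))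
    where
    x<ρ′ : x < Γq-ratio (2 ℕ.+ k)
    x<ρ′ = ≰⇒> λ ρ′≤x → ≤⇒≯ (ub (2 ℕ.+ k , ℕ.s≤s ℕ.z≤n , ρ′≤x , refl)) (begin-strict
      Z            ≈⟨ Z≈ ⟩
      [ suc k ]q   <⟨ []q-<-suc (suc k) ⟩
      [ 2 ℕ.+ k ]q ∎)

theorem2p1 : ∀ {c ℓ₁ ℓ₂} (ℝ : RealField c ℓ₁ ℓ₂) →
    let open RealField ℝ
        open RealFieldProperties ℝ using (√_)
    in
    (q : Carrier) (0<q : 0# < q) (q<1 : q < 1#) →
    let open QGamma ℝ q 0<q q<1 in
    (x : Carrier) → Γq 3 / (fromℕ 2 * Γq 1) ≤ x →
    (Z : Carrier) → IsZ* x Z →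
      ((√ (1# + fromℕ 8 * x * q) - (1# + fromℕ 2 * q)) / (fromℕ 2 * q ^ 2) < Z)
    × (Z ≤ (√ (1# + fromℕ 8 * x * q) - 1#) / (fromℕ 2 * q))
theorem2p1 ℝ q 0<q q<1 x _ Z isZ* = Z*-lower isZ* , Z*-upper isZ*
  where open QGammaLemmas ℝ q 0<q q<1
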